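{- Let $k$ be a positive integer and let $T$ be a tournament on $n$ vertices with $n \geq (2k-1)2^{2k}$. Then $\mathrm{sinv}'_k(T) \leq \mathrm{sinv}_k(T) \leq 1$.
   Context: A tournament is an orientation of a complete graph. For a digraph $D$ and $X \subseteq V(D)$, inverting $X$ means reversing the direction of every arc of $D$ with both endvertices in $X$. A digraph $D$ is $k$-arc-strong if for every partition $(V_1,V_2)$ of $V(D)$ into nonempty sets there are at least $k$ arcs from $V_1$ to $V_2$; it is $k$-strong if $|V(D)|\ge k+1$ and $D-S$ is strongly connected for every $S\subseteq V(D)$ with $|S|<k$. $\mathrm{sinv}'_k(D)$ (resp. $\mathrm{sinv}_k(D)$) is the minimum number of sets whose successive inversion transforms $D$ into a $k$-arc-strong (resp. $k$-strong) digraph. -}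

module Defs where

open import Data.Bool using (Bool; true; false; not; if_then_else_; T)
open import Data.Bool.Properties using (T?)
open import Data.Fin using (Fin)
open import Data.Fin.Subset using (Subset; _∈_; _∉_; ∁; ∣_∣; Nonempty)
open import Data.Fin.Subset.Properties using (_∈?_)
open import Data.List using (List; length; filter; allFin; cartesianProduct)
open import Data.Nat using (ℕ; _+_; _≤_; _<_)
open import Data.Product using (_×_; _,_; ∃-syntax)
open import Data.Vec using (Vec; []; _∷_)
open import Relation.Binary.Construct.Closure.ReflexiveTransitive using (Star)
open import Relation.Binary.PropositionalEquality using (_≡_; _≢_)
open import Relation.Nullary using (does)
open import Relation.Nullary.Decidable using (_×-dec_)

-- D u v ≡ true means that uv is an arc.
Digraph : ℕ → Set
Digraph n = Fin n → Fin n → Bool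

record IsTournament {n : ℕ} (D : Digraph n) : Set where
  field
    noLoops : ∀ u → D u u ≡ false
    oneArc  : ∀ {u v} → u ≢ v → D u v ≡ not (D v u)

invert : ∀ {n} → Subset n → Digraph n → Digraph n
invert X D u v = if does ((u ∈? X) ×-dec (v ∈? X)) then D v u else D u v

invertAll : ∀ {n m} → Vec (Subset n) m → Digraph n → Digraph n
invertAll []       D = D
invertAll (X ∷ Xs) D = invertAll Xs (invert X D)

arcsFromTo : ∀ {n} → Digraph n → Subset n → Subset n → List (Fin n × Fin n)
arcsFromTo {n} D X Y =
  filter (λ (u , v) → (u ∈? X) ×-dec ((v ∈? Y) ×-dec T? (D u v)))
         (cartesianProduct (allFin n) (allFin n))

-- A partition into two nonempty parts is given by its first part V₁.
ArcStrong : ∀ {n} → ℕ → Digraph n → Set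
ArcStrong k D = ∀ V₁ → Nonempty V₁ → Nonempty (∁ V₁) →
                k ≤ length (arcsFromTo D V₁ (∁ V₁))

-- The arc relation of D − S.  Deleted vertices remain in the type Fin n but
-- are isolated; StronglyConnectedMinus quantifies over the surviving ones only.
ArcMinus : ∀ {n} → Digraph n → Subset n → Fin n → Fin n → Set
ArcMinus D S u v = u ∉ S × v ∉ S × T (D u v)

StronglyConnectedMinus : ∀ {n} → Digraph n → Subset n → Set
StronglyConnectedMinus D S = ∀ u v → u ∉ S → v ∉ S → Star (ArcMinus D S) u v

Strong : ∀ {n} → ℕ → Digraph n → Set
Strong {n} k D = k + 1 ≤ n × (∀ S → ∣ S ∣ < k → StronglyConnectedMinus D S)

IsMinimum : (ℕ → Set) → ℕ → Set
IsMinimum P m = P m × (∀ j → P j → m ≤ j)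

-- A digraph need not be transformable at all, so sinv′ and sinv are partial
-- functions and are given by their graphs: "sinv′ₖ(D) = m", "sinvₖ(D) = m".
Sinv′≡ : ∀ {n} → ℕ → Digraph n → ℕ → Set
Sinv′≡ {n} k D = IsMinimum (λ m → ∃[ Xs ] ArcStrong k (invertAll {n} {m} Xs D))

Sinv≡ : ∀ {n} → ℕ → Digraph n → ℕ → Set
Sinv≡ {n} k D = IsMinimum (λ m → ∃[ Xs ] Strong k (invertAll {n} {m} Xs D))

{-# OPTIONS --safe #-}
-- Picking vertices of large out-degree k times, and then vertices of large
-- in-degree k times, each time restricting to the chosen neighbourhood, gives
-- A, B of size k and Z of size 2k − 1 with A ⇒ Z ⇒ B and A ⇒ B; this costs a
-- factor 2^(2k).  Inverting Y = A ∪ B makes the core cyclic: A ⇒ Z ⇒ B ⇒ A.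
-- A vertex v outside the core has k out- or k in-neighbours in Y, and k out- or
-- k in-neighbours in Z.  If the two directions can only be chosen equal, add v
-- to the inverted set: this reverses its arcs to Y but not those to Z.  Hence v
-- ends up with k out-neighbours and k in-neighbours in the core, and deleting
-- fewer than k vertices cannot disconnect the result.
module Submission where

open import Data.Bool using (true; false; T; if_then_else_)
open import Data.Bool.Properties using (T?)
open import Data.Fin using (Fin; zero; suc; _≟_)
open import Data.Fin.Properties using (any?; all?)
open import Data.Fin.Subset using (Subset; _∈_; _∉_; _⊆_; _∪_; ∁; ⊤; ⊥; ⁅_⁆; ∣_∣; inside; outside)
open import Data.Fin.Subset.Properties
open import Data.List using (List; []; _∷_; length; map; allFin; cartesianProduct)
open import Data.List.Membership.Propositional using () renaming (_∈_ to _∈ₗ_)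
open import Data.List.Membership.Propositional.Properties using (∈-filter⁺; ∈-filter⁻; ∈-cartesianProduct⁺; ∈-allFin; ∈-map⁺; ∈-map⁻)
open import Data.List.Properties using (length-map)
open import Data.List.Relation.Unary.Any using (here; there)
open import Data.Nat using (ℕ; zero; suc; _+_; _*_; _∸_; _^_; _≤_; _<_; z≤n; s≤s; _≤?_; _<?_)
open import Data.Nat.Properties hiding (_≟_; _≤?_; _<?_)
open import Data.Product using (_×_; _,_; ∃-syntax; proj₁; proj₂)
open import Data.Sum using (_⊎_; inj₁; inj₂; [_,_]′)
open import Data.Vec as Vec using (Vec; []; _∷_; tabulate)
open import Data.Vec.Properties using (lookup⇒[]=; []=⇒lookup; lookup∘tabulate)
open import Function using (_∘_; flip)
open import Relation.Binary using (Rel)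
open import Relation.Binary.Construct.Closure.ReflexiveTransitive using (Star; ε; _◅_; _◅◅_)
open import Relation.Binary.PropositionalEquality using (_≡_; _≢_; refl; sym; trans; cong; subst; ≢-sym)
open import Relation.Nullary using (¬_; Dec; yes; no; does; contradiction)
open import Relation.Nullary.Decidable using (_×-dec_; _⊎-dec_; _→-dec_; ¬?; map′; dec-true; dec-false; decidable-stable; toSum)
open import Relation.Unary using (Pred; Decidable)
open import Relation.Binary.Definitions using () renaming (Decidable to Decidable₂)
open import Level using (0ℓ)
open import Defs

open import Algebra.Properties.CommutativeMonoid.Sum +-0-commutativeMonoid using (sum; ∑-comm; sum-cong-≗)

private
  variable
    n : ℕ

-- Subsets of Fin n

select : {P : Pred (Fin n) 0ℓ} → Decidable P → Subset n
select P? = tabulate (does ∘ P?)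

module _ {P : Pred (Fin n) 0ℓ} (P? : Decidable P) where

  ∈-select⁺ : ∀ {x} → P x → x ∈ select P?
  ∈-select⁺ {x} px = lookup⇒[]= x _ (trans (lookup∘tabulate _ x) (dec-true (P? x) px))

  ∈-select⁻ : ∀ {x} → x ∈ select P? → P x
  ∈-select⁻ {x} x∈ with P? x | trans (sym (lookup∘tabulate (does ∘ P?) x)) ([]=⇒lookup x∈)
  ... | yes px | _  = px
  ... | no  _  | ()

-- A sum of indicators is the form in which `∑-comm` can exchange summations, as the double counting
-- of arcs requires.
∣select∣ : {P : Pred (Fin n) 0ℓ} (P? : Decidable P) →
           ∣ select P? ∣ ≡ sum (λ i → if does (P? i) then 1 else 0)
∣select∣ {zero}  P? = refl
∣select∣ {suc n} P? with does (P? zero)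
... | true  = cong suc (∣select∣ (P? ∘ suc))
... | false = ∣select∣ (P? ∘ suc)

∣p∪q∣≤∣p∣+∣q∣ : (p q : Subset n) → ∣ p ∪ q ∣ ≤ ∣ p ∣ + ∣ q ∣
∣p∪q∣≤∣p∣+∣q∣ []            []            = z≤n
∣p∪q∣≤∣p∣+∣q∣ (outside ∷ p) (outside ∷ q) = ∣p∪q∣≤∣p∣+∣q∣ p q
∣p∪q∣≤∣p∣+∣q∣ (outside ∷ p) (inside  ∷ q) = ≤-trans (s≤s (∣p∪q∣≤∣p∣+∣q∣ p q)) (≤-reflexive (sym (+-suc _ _)))
∣p∪q∣≤∣p∣+∣q∣ (inside  ∷ p) (outside ∷ q) = s≤s (∣p∪q∣≤∣p∣+∣q∣ p q)
∣p∪q∣≤∣p∣+∣q∣ (inside  ∷ p) (inside  ∷ q) =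
  s≤s (≤-trans (∣p∪q∣≤∣p∣+∣q∣ p q) (+-monoʳ-≤ ∣ p ∣ (n≤1+n _)))

disjoint⇒∣p∣+∣q∣≤∣p∪q∣ : (p q : Subset n) → (∀ {x} → x ∈ p → x ∉ q) → ∣ p ∣ + ∣ q ∣ ≤ ∣ p ∪ q ∣
disjoint⇒∣p∣+∣q∣≤∣p∪q∣ []            []            _  = z≤n
disjoint⇒∣p∣+∣q∣≤∣p∪q∣ (s ∷ p) (t ∷ q) dj with disjoint⇒∣p∣+∣q∣≤∣p∪q∣ p q (λ x∈p x∈q → dj (Vec.there x∈p) (Vec.there x∈q))
disjoint⇒∣p∣+∣q∣≤∣p∪q∣ (outside ∷ p) (outside ∷ q) dj | ih = ih
disjoint⇒∣p∣+∣q∣≤∣p∪q∣ (outside ∷ p) (inside  ∷ q) dj | ih = ≤-trans (≤-reflexive (+-suc _ _)) (s≤s ih)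
disjoint⇒∣p∣+∣q∣≤∣p∪q∣ (inside  ∷ p) (outside ∷ q) dj | ih = s≤s ih
disjoint⇒∣p∣+∣q∣≤∣p∪q∣ (inside  ∷ p) (inside  ∷ q) dj | ih = contradiction Vec.here (dj Vec.here)

x∉p⇒∣p∣<∣⁅x⁆∪p∣ : ∀ {x} (p : Subset n) → x ∉ p → ∣ p ∣ < ∣ ⁅ x ⁆ ∪ p ∣
x∉p⇒∣p∣<∣⁅x⁆∪p∣ {x = x} p x∉p =
  p⊂q⇒∣p∣<∣q∣ (q⊆p∪q ⁅ x ⁆ p , x , p⊆p∪q p (x∈⁅x⁆ x) , x∉p)

1≤∣p∣⇒Nonempty : (p : Subset n) → 1 ≤ ∣ p ∣ → ∃[ x ] x ∈ p
1≤∣p∣⇒Nonempty {n} p 1≤∣p∣ with nonempty? p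
... | yes ne = ne
... | no  em = contradiction (subst (1 ≤_) (trans (cong ∣_∣ (Empty-unique em)) (∣⊥∣≡0 n)) 1≤∣p∣) λ ()

∣q∣<∣p∣⇒∃∈p∉q : (p q : Subset n) → ∣ q ∣ < ∣ p ∣ → ∃[ x ] (x ∈ p × x ∉ q)
∣q∣<∣p∣⇒∃∈p∉q p q q<p with any? (λ x → x ∈? p ×-dec ¬? (x ∈? q))
... | yes ∃x = ∃x
... | no  ∄x = contradiction q<p (≤⇒≯ (p⊆q⇒∣p∣≤∣q∣ λ {x} x∈p →
                 decidable-stable (x ∈? q) λ x∉q → ∄x (x , x∈p , x∉q)))

-- Repetitions collapse, so a list of chosen endpoints, one per arc, gives a set no larger than the
-- number of arcs.
fromList : List (Fin n) → Subset n
fromList []       = ⊥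
fromList (x ∷ xs) = ⁅ x ⁆ ∪ fromList xs

∣fromList∣≤length : (xs : List (Fin n)) → ∣ fromList xs ∣ ≤ length xs
∣fromList∣≤length {n} []       = ≤-reflexive (∣⊥∣≡0 n)
∣fromList∣≤length     (x ∷ xs) = ≤-trans (∣p∪q∣≤∣p∣+∣q∣ ⁅ x ⁆ (fromList xs))
  (+-mono-≤ (≤-reflexive (∣⁅x⁆∣≡1 x)) (∣fromList∣≤length xs))

∈-fromList⁺ : ∀ {x} {xs : List (Fin n)} → x ∈ₗ xs → x ∈ fromList xs
∈-fromList⁺ {xs = x ∷ xs} (here refl) = p⊆p∪q (fromList xs) (x∈⁅x⁆ x)
∈-fromList⁺ {xs = x ∷ xs} (there x∈)  = q⊆p∪q ⁅ x ⁆ (fromList xs) (∈-fromList⁺ x∈)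

∈-fromList⁻ : ∀ {x} (xs : List (Fin n)) → x ∈ fromList xs → x ∈ₗ xs
∈-fromList⁻ []       x∈ = contradiction x∈ ∉⊥
∈-fromList⁻ (y ∷ xs) x∈ with x∈p∪q⁻ ⁅ y ⁆ (fromList xs) x∈
... | inj₁ x∈⁅y⁆ = here (x∈⁅y⁆⇒x≡y y x∈⁅y⁆)
... | inj₂ x∈xs  = there (∈-fromList⁻ xs x∈xs)

allSubset? : {P : Pred (Subset n) 0ℓ} → Decidable P → Dec (∀ s → P s)
allSubset? P? with anySubset? (¬? ∘ P?)
... | yes (s , ¬p) = no λ ∀p → ¬p (∀p s)
... | no  ∄s       = yes λ s → decidable-stable (P? s) λ ¬p → ∄s (s , ¬p)

-- Reachability and cuts

module _ {R : Rel (Fin n) 0ℓ} where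

  Crosses : Subset n → Set
  Crosses V = ∃[ x ] ∃[ y ] (x ∈ V × y ∉ V × R x y)

  Star⇒Crosses : ∀ {u v} V → Star R u v → u ∈ V → v ∉ V → Crosses V
  Star⇒Crosses V ε u∈ v∉ = contradiction u∈ v∉
  Star⇒Crosses V (_◅_ {j = w} uRw wR*v) u∈ v∉ with w ∈? V
  ... | yes w∈ = Star⇒Crosses V wR*v w∈ v∉
  ... | no  w∉ = _ , _ , u∈ , w∉ , uRw

  module _ {u v : Fin n} (crosses : ∀ V → u ∈ V → v ∉ V → Crosses V) where

    -- `V` collects vertices known to be reachable, and `fuel` bounds how many lie outside it. Each
    -- crossing arc adds one vertex; with no fuel left `V` is everything and contains `v`.
    growReachable : ∀ fuel V → n ≤ ∣ V ∣ + fuel → u ∈ V → (∀ {w} → w ∈ V → Star R u w) → Star R u v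
    growReachable fuel V enough u∈ reach with v ∈? V
    ... | yes v∈ = reach v∈
    growReachable zero V enough u∈ reach | no v∉ =
      contradiction (subst (v ∈_) (sym (∣p∣≡n⇒p≡⊤ (≤-antisym (∣p∣≤n V) (subst (n ≤_) (+-identityʳ _) enough)))) ∈⊤) v∉
    growReachable (suc fuel) V enough u∈ reach | no v∉ with crosses V u∈ v∉
    ... | x , y , x∈ , y∉ , xRy = growReachable fuel (⁅ y ⁆ ∪ V)
      (≤-trans enough (≤-trans (≤-reflexive (+-suc _ fuel)) (+-monoˡ-≤ fuel (x∉p⇒∣p∣<∣⁅x⁆∪p∣ V y∉))))
      (q⊆p∪q ⁅ y ⁆ V u∈) reach′
      where
      reach′ : ∀ {w} → w ∈ ⁅ y ⁆ ∪ V → Star R u w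
      reach′ w∈ with x∈p∪q⁻ ⁅ y ⁆ V w∈
      ... | inj₂ w∈V = reach w∈V
      ... | inj₁ w∈y with refl ← x∈⁅y⁆⇒x≡y y w∈y = reach x∈ ◅◅ (xRy ◅ ε)

    Crosses⇒Star : Star R u v
    Crosses⇒Star = growReachable n ⁅ u ⁆ (m≤n+m n _) (x∈⁅x⁆ u)
      λ w∈ → subst (Star R u) (sym (x∈⁅y⁆⇒x≡y u w∈)) ε

  -- Reachability is equivalent to a finite condition: every vertex set containing `u` but not `v`
  -- is left by an arc.
  Star? : Decidable₂ R → Decidable₂ (Star R)
  Star? R? u v = map′ Crosses⇒Star (λ s V → Star⇒Crosses V s)
    (allSubset? λ V → u ∈? V →-dec (¬? (v ∈? V) →-dec
      any? λ x → any? λ y → x ∈? V ×-dec (¬? (y ∈? V) ×-dec R? x y)))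

-- Strong and arc-strong digraphs

strong? : ∀ k (D : Digraph n) → Dec (Strong k D)
strong? {n} k D = (k + 1 ≤? n) ×-dec allSubset? λ S → (∣ S ∣ <? k) →-dec
  all? λ u → all? λ v → ¬? (u ∈? S) →-dec (¬? (v ∈? S) →-dec
    Star? (λ x y → ¬? (x ∈? S) ×-dec (¬? (y ∈? S) ×-dec T? (D x y))) u v)

arcStrong? : ∀ k (D : Digraph n) → Dec (ArcStrong k D)
arcStrong? k D = allSubset? λ V → nonempty? V →-dec (nonempty? (∁ V) →-dec (k ≤? _))

-- A choice of one endpoint per arc that avoids `u` on loopless arcs. It serves both to count the
-- arcs of a cut and to build a separator from them.
endpointOff : Fin n → Fin n × Fin n → Fin n
endpointOff u (x , y) = if does (x ≟ u) then y else x

endpointOff-≡ : ∀ (u y : Fin n) → endpointOff u (u , y) ≡ y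
endpointOff-≡ u y rewrite dec-true (u ≟ u) refl = refl

endpointOff-≢ : ∀ {u x : Fin n} y → x ≢ u → endpointOff u (x , y) ≡ x
endpointOff-≢ {u = u} {x} y x≢u rewrite dec-false (x ≟ u) x≢u = refl

module _ (D : Digraph n) (V : Subset n) where

  private
    cut : List (Fin n × Fin n)
    cut = arcsFromTo D V (∁ V)

  ∈-cut⁺ : ∀ {x y} → x ∈ V → y ∉ V → T (D x y) → (x , y) ∈ₗ cut
  ∈-cut⁺ x∈ y∉ xy = ∈-filter⁺ _ (∈-cartesianProduct⁺ (∈-allFin _) (∈-allFin _)) (x∈ , x∉p⇒x∈∁p y∉ , xy)

  ∈-cut⁻ : ∀ {x y} → (x , y) ∈ₗ cut → x ∈ V × y ∉ V × T (D x y)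
  ∈-cut⁻ xy∈ with _ , x∈ , y∈ , xy ← ∈-filter⁻ _ {xs = cartesianProduct (allFin n) (allFin n)} xy∈ =
    x∈ , x∈∁p⇒x∉p y∈ , xy

  private
    ends : Fin n → List (Fin n)
    ends u = map (endpointOff u) cut

    length-ends : ∀ u → length (ends u) ≡ length cut
    length-ends u = length-map (endpointOff u) cut

  -- Each `w` other than `u` is the chosen endpoint of some arc of the cut: of `(w , v)` if `w` lies
  -- in `V`, and of `(u , w)` otherwise.
  completeCut⇒n≤1+∣cut∣ : ∀ {u v} → u ∈ V → v ∉ V → (∀ {x y} → x ∈ V → y ∉ V → T (D x y)) → n ≤ 1 + length cut
  completeCut⇒n≤1+∣cut∣ {u} {v} u∈ v∉ complete = begin
    n                          ≡⟨ ∣⊤∣≡n n ⟨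
    ∣ ⊤ {n} ∣                  ≤⟨ p⊆q⇒∣p∣≤∣q∣ {p = ⊤} (λ _ → ∈-fromList⁺ (covered _)) ⟩
    ∣ fromList (u ∷ ends u) ∣  ≤⟨ ∣fromList∣≤length (u ∷ ends u) ⟩
    1 + length (ends u)        ≡⟨ cong suc (length-ends u) ⟩
    1 + length cut             ∎
    where
    open ≤-Reasoning
    covered : ∀ w → w ∈ₗ u ∷ ends u
    covered w with w ≟ u | w ∈? V
    ... | yes w≡u | _      = here w≡u
    ... | no  w≢u | yes w∈ = there (subst (_∈ₗ ends u) (endpointOff-≢ v w≢u) (∈-map⁺ _ (∈-cut⁺ w∈ v∉ (complete w∈ v∉))))
    ... | no  w≢u | no  w∉ = there (subst (_∈ₗ ends u) (endpointOff-≡ u w) (∈-map⁺ _ (∈-cut⁺ u∈ w∉ (complete u∈ w∉))))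

  -- Deleting from each arc of the cut an endpoint other than u and v
  -- separates u from v.
  nonArc⇒k≤∣cut∣ : ∀ {k u v} → Strong k D → u ∈ V → v ∉ V → ¬ T (D u v) → k ≤ length cut
  nonArc⇒k≤∣cut∣ {k} {u} {v} (_ , strong) u∈ v∉ ¬uv = ≮⇒≥ impossible
    where
    S : Subset n
    S = fromList (ends u)

    u∉S : u ∉ S
    u∉S u∈S with (x , y) , xy∈ , u≡ ← ∈-map⁻ (endpointOff u) (∈-fromList⁻ (ends u) u∈S)
            with _ , y∉ , _ ← ∈-cut⁻ xy∈ | x ≟ u
    ... | yes refl = y∉ (subst (_∈ V) u≡ u∈)
    ... | no  x≢u  = x≢u (sym u≡)

    -- Tails of cut arcs lie in `V`, so `v` could be chosen only as the head of an arc from `u`,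
    -- which is the missing arc.
    v∉S : v ∉ S
    v∉S v∈S with (x , y) , xy∈ , v≡ ← ∈-map⁻ (endpointOff u) (∈-fromList⁻ (ends u) v∈S)
            with x∈ , _ , xy ← ∈-cut⁻ xy∈ | x ≟ u
    ... | yes refl = ¬uv (subst (T ∘ D u) (sym v≡) xy)
    ... | no  x≢u  = v∉ (subst (_∈ V) (sym v≡) x∈)

    -- A path from `u` to `v` avoiding `S` would still cross the cut, yet every arc of the cut has
    -- an endpoint in `S`.
    impossible : ¬ length cut < k
    impossible cut<k
      with x , y , x∈ , y∉ , x∉S , y∉S , xy ← Star⇒Crosses V
             (strong S (<-≤-trans (s≤s (≤-trans (∣fromList∣≤length (ends u)) (≤-reflexive (length-ends u)))) cut<k) u v u∉S v∉S) u∈ v∉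
      with e∈ ← ∈-fromList⁺ (∈-map⁺ (endpointOff u) (∈-cut⁺ x∈ y∉ xy))
      with x ≟ u
    ... | yes _ = y∉S e∈
    ... | no  _ = x∉S e∈

-- If some arc across the cut is missing, its ends are separated by as many vertices as the cut has
-- arcs. If none is missing, the cut has at least `n - 1` arcs, and `k + 1 ≤ n`.
Strong⇒ArcStrong : ∀ {k} {D : Digraph n} → Strong k D → ArcStrong k D
Strong⇒ArcStrong {n} {k} {D} strong V (u , u∈) (v , v∈) =
  byCases (any? λ x → any? λ y → x ∈? V ×-dec (¬? (y ∈? V) ×-dec ¬? (T? (D x y))))
  where
  byCases : Dec (∃[ x ] ∃[ y ] (x ∈ V × y ∉ V × ¬ T (D x y))) → k ≤ length (arcsFromTo D V (∁ V))
  byCases (yes (x , y , x∈ , y∉ , ¬xy)) = nonArc⇒k≤∣cut∣ D V strong x∈ y∉ ¬xy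
  byCases (no ∄xy) = ≤-pred (≤-trans (≤-reflexive (sym (+-comm k 1))) (≤-trans (proj₁ strong)
    (completeCut⇒n≤1+∣cut∣ D V u∈ (x∈∁p⇒x∉p v∈)
      λ {x} {y} x∈ y∉ → decidable-stable (T? (D x y)) λ ¬xy → ∄xy (x , y , x∈ , y∉ , ¬xy))))

-- Neighbourhoods in tournaments

sum-mono-≤ : {f g : Fin n → ℕ} → (∀ i → f i ≤ g i) → sum f ≤ sum g
sum-mono-≤ {zero}  f≤g = z≤n
sum-mono-≤ {suc n} f≤g = +-mono-≤ (f≤g zero) (sum-mono-≤ (f≤g ∘ suc))

sum-mono-< : {f g : Fin n → ℕ} → (∀ i → f i ≤ g i) → ∀ j → f j < g j → sum f < sum g
sum-mono-< f≤g zero    f<g = +-mono-<-≤ f<g (sum-mono-≤ (f≤g ∘ suc))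
sum-mono-< f≤g (suc j) f<g = +-mono-≤-< (f≤g zero) (sum-mono-< (f≤g ∘ suc) j f<g)

-- Both sums count the pairs related by `R`.
outDegreeSum≡inDegreeSum : {R : Rel (Fin n) 0ℓ} (R? : Decidable₂ R) →
  sum (λ u → ∣ select (R? u) ∣) ≡ sum (λ u → ∣ select (flip R? u) ∣)
outDegreeSum≡inDegreeSum R? = trans (sum-cong-≗ λ u → ∣select∣ (R? u))
  (trans (∑-comm λ u v → if does (R? u v) then 1 else 0)
         (sum-cong-≗ λ u → sym (∣select∣ (flip R? u))))

_⇒[_]_ : Subset n → Digraph n → Subset n → Set
P ⇒[ D ] Q = ∀ {x y} → x ∈ P → y ∈ Q → T (D x y)

-- Passing `flip D` gives in-neighbours, so one definition covers both directions.
nbrs : Digraph n → Subset n → Fin n → Subset n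
nbrs D W v = select λ w → w ∈? W ×-dec T? (D v w)

module _ (D : Digraph n) (W : Subset n) {v : Fin n} where

  ∈-nbrs⁺ : ∀ {w} → w ∈ W → T (D v w) → w ∈ nbrs D W v
  ∈-nbrs⁺ w∈ vw = ∈-select⁺ (λ w → w ∈? W ×-dec T? (D v w)) (w∈ , vw)

  ∈-nbrs⁻ : ∀ {w} → w ∈ nbrs D W v → w ∈ W × T (D v w)
  ∈-nbrs⁻ = ∈-select⁻ (λ w → w ∈? W ×-dec T? (D v w))

flip-isTournament : {D : Digraph n} → IsTournament D → IsTournament (flip D)
flip-isTournament tour = record
  { noLoops = IsTournament.noLoops tour
  ; oneArc  = λ u≢v → IsTournament.oneArc tour (≢-sym u≢v)
  }

module _ {D : Digraph n} (tour : IsTournament D) where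

  open IsTournament tour

  ¬loop : ∀ u → ¬ T (D u u)
  ¬loop u uu = subst T (noLoops u) uu

  arc : ∀ {u v} → u ≢ v → T (D u v) ⊎ T (D v u)
  arc {u} {v} u≢v with D u v | D v u | oneArc u≢v
  ... | true  | _    | _ = inj₁ _
  ... | false | true | _ = inj₂ _

  ⇒-disjoint : ∀ {P Q} → P ⇒[ D ] Q → ∀ {x} → x ∈ P → x ∉ Q
  ⇒-disjoint P⇒Q x∈P x∈Q = ¬loop _ (P⇒Q x∈P x∈Q)

  ∣W∣≤1+out+in : ∀ W v → ∣ W ∣ ≤ 1 + (∣ nbrs D W v ∣ + ∣ nbrs (flip D) W v ∣)
  ∣W∣≤1+out+in W v = begin
    ∣ W ∣                        ≤⟨ p⊆q⇒∣p∣≤∣q∣ cover ⟩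
    ∣ ⁅ v ⁆ ∪ (out ∪ in′) ∣      ≤⟨ ∣p∪q∣≤∣p∣+∣q∣ ⁅ v ⁆ (out ∪ in′) ⟩
    ∣ ⁅ v ⁆ ∣ + ∣ out ∪ in′ ∣    ≤⟨ +-mono-≤ (≤-reflexive (∣⁅x⁆∣≡1 v)) (∣p∪q∣≤∣p∣+∣q∣ out in′) ⟩
    1 + (∣ out ∣ + ∣ in′ ∣)      ∎
    where
    open ≤-Reasoning
    out = nbrs D W v
    in′ = nbrs (flip D) W v
    cover : W ⊆ ⁅ v ⁆ ∪ (out ∪ in′)
    cover {w} w∈ with v ≟ w
    ... | yes refl = p⊆p∪q (out ∪ in′) (x∈⁅x⁆ v)
    ... | no  v≢w  with arc v≢w
    ...   | inj₁ vw = q⊆p∪q ⁅ v ⁆ (out ∪ in′) (p⊆p∪q in′ (∈-nbrs⁺ D W w∈ vw))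
    ...   | inj₂ wv = q⊆p∪q ⁅ v ⁆ (out ∪ in′) (q⊆p∪q out in′ (∈-nbrs⁺ (flip D) W w∈ wv))

  ∣W∣≤out+in : ∀ W {v} → v ∉ W → ∣ W ∣ ≤ ∣ nbrs D W v ∣ + ∣ nbrs (flip D) W v ∣
  ∣W∣≤out+in W {v} v∉ = ≤-trans (p⊆q⇒∣p∣≤∣q∣ cover) (∣p∪q∣≤∣p∣+∣q∣ (nbrs D W v) (nbrs (flip D) W v))
    where
    cover : W ⊆ nbrs D W v ∪ nbrs (flip D) W v
    cover {w} w∈ with arc {v} {w} (λ { refl → v∉ w∈ })
    ... | inj₁ vw = p⊆p∪q _ (∈-nbrs⁺ D W w∈ vw)
    ... | inj₂ wv = q⊆p∪q (nbrs D W v) _ (∈-nbrs⁺ (flip D) W w∈ wv)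

  -- Pigeonhole: fewer than `k` neighbours in each direction would account for at most `2k - 2`
  -- vertices of `W`.
  majority : ∀ {k} W {v} → 2 * k ∸ 1 ≤ ∣ W ∣ → v ∉ W →
             k ≤ ∣ nbrs D W v ∣ ⊎ k ≤ ∣ nbrs (flip D) W v ∣
  majority {k} W {v} 2k-1≤ v∉ with k ≤? ∣ nbrs D W v ∣ | k ≤? ∣ nbrs (flip D) W v ∣
  ... | yes k≤out | _        = inj₁ k≤out
  ... | no  _     | yes k≤in = inj₂ k≤in
  ... | no  k≰out | no  k≰in = contradiction chain (<-irrefl refl)
    where
    open ≤-Reasoning
    o = ∣ nbrs D W v ∣
    i = ∣ nbrs (flip D) W v ∣
    chain : 1 + (o + i) < 1 + (o + i)
    chain = begin-strict
      1 + (o + i)        <⟨ ≤-reflexive (cong suc (sym (+-suc o i))) ⟩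
      suc o + suc i      ≤⟨ +-mono-≤ (≰⇒> k≰out) (≰⇒> k≰in) ⟩
      k + k              ≡⟨ cong (k +_) (+-identityʳ k) ⟨
      2 * k              ≤⟨ m≤n+m∸n (2 * k) 1 ⟩
      1 + (2 * k ∸ 1)    ≤⟨ s≤s (≤-trans 2k-1≤ (∣W∣≤out+in W v∉)) ⟩
      1 + (o + i)        ∎

  -- If all out-degrees inside W were below m, every in-degree inside W would
  -- exceed the corresponding out-degree, yet both have the same sum.
  largeOutDegree : ∀ m W → 1 ≤ m → 2 * m ≤ ∣ W ∣ → ∃[ v ] (v ∈ W × m ≤ ∣ nbrs D W v ∣)
  largeOutDegree m W 1≤m 2m≤ with any? (λ v → v ∈? W ×-dec m ≤? ∣ nbrs D W v ∣)
  ... | yes found = found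
  ... | no  none  = contradiction (outDegreeSum≡inDegreeSum R?)
                      (<⇒≢ (sum-mono-< row≤col (proj₁ W≠∅) (row<col (proj₂ W≠∅))))
    where
    R? : Decidable₂ (λ u v → u ∈ W × v ∈ W × T (D u v))
    R? u v = u ∈? W ×-dec (v ∈? W ×-dec T? (D u v))

    W≠∅ : ∃[ w ] w ∈ W
    W≠∅ = 1≤∣p∣⇒Nonempty W (≤-trans 1≤m (≤-trans (m≤n*m m 2) 2m≤))

    row<col : ∀ {u} → u ∈ W → ∣ select (R? u) ∣ < ∣ select (flip R? u) ∣
    row<col {u} u∈ = <-≤-trans (≤-<-trans (p⊆q⇒∣p∣≤∣q∣ row⊆out) (<-≤-trans out<m m≤in)) (p⊆q⇒∣p∣≤∣q∣ in⊆col)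
      where
      open ≤-Reasoning
      o = ∣ nbrs D W u ∣
      i = ∣ nbrs (flip D) W u ∣
      row⊆out : select (R? u) ⊆ nbrs D W u
      row⊆out w∈ with _ , w∈W , uw ← ∈-select⁻ (R? u) w∈ = ∈-nbrs⁺ D W w∈W uw
      in⊆col : nbrs (flip D) W u ⊆ select (flip R? u)
      in⊆col w∈ with w∈W , wu ← ∈-nbrs⁻ (flip D) W w∈ = ∈-select⁺ (flip R? u) (w∈W , u∈ , wu)
      out<m : o < m
      out<m = ≰⇒> λ m≤o → none (u , u∈ , m≤o)
      m≤in : m ≤ i
      m≤in = +-cancelˡ-≤ m m i (begin
        m + m          ≡⟨ cong (m +_) (+-identityʳ m) ⟨
        2 * m          ≤⟨ 2m≤ ⟩
        ∣ W ∣          ≤⟨ ∣W∣≤1+out+in W u ⟩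
        suc o + i      ≤⟨ +-monoˡ-≤ i out<m ⟩
        m + i          ∎)

    -- Outside `W` the rows are empty, so the strict inequality at a vertex of `W` makes the whole
    -- sum strict.
    row≤col : ∀ u → ∣ select (R? u) ∣ ≤ ∣ select (flip R? u) ∣
    row≤col u = [ <⇒≤ ∘ row<col
                , (λ u∉ → p⊆q⇒∣p∣≤∣q∣ {p = select (R? u)} {q = select (flip R? u)} λ w∈ → contradiction (proj₁ (∈-select⁻ (R? u) w∈)) u∉)
                ]′ (toSum (u ∈? W))

  -- A vertex of large out-degree in `W` joins `A`, and the search continues in its
  -- out-neighbourhood. Each of the `j` rounds costs a factor 2.
  dominatingSubset : ∀ j m W → 1 ≤ m → m * 2 ^ j ≤ ∣ W ∣ →
    ∃[ A ] ∃[ W′ ] (A ⊆ W × W′ ⊆ W × j ≤ ∣ A ∣ × m ≤ ∣ W′ ∣ × A ⇒[ D ] W′)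
  dominatingSubset zero    m W 1≤m big =
    ⊥ , W , ⊥⊆ , ⊆-refl , z≤n , subst (_≤ ∣ W ∣) (*-identityʳ m) big , λ x∈ → contradiction x∈ ∉⊥
  dominatingSubset (suc j) m W 1≤m big
    with v , v∈ , large ← largeOutDegree (m * 2 ^ j) W (*-mono-≤ 1≤m (m^n>0 2 j))
           (subst (_≤ ∣ W ∣) (trans (sym (*-assoc m 2 _)) (trans (cong (_* 2 ^ j) (*-comm m 2)) (*-assoc 2 m _))) big)
    with A , W′ , A⊆ , W′⊆ , j≤ , m≤ , A⇒W′ ← dominatingSubset j m (nbrs D W v) 1≤m large
    = ⁅ v ⁆ ∪ A , W′ , ⁅v⁆∪A⊆W , proj₁ ∘ ∈-nbrs⁻ D W ∘ W′⊆
    -- Without loops `v` is outside its own neighbourhood, hence new to `A`.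
    , ≤-<-trans j≤ (x∉p⇒∣p∣<∣⁅x⁆∪p∣ A λ v∈A → ¬loop v (proj₂ (∈-nbrs⁻ D W (A⊆ v∈A))))
    , m≤ , ⁅v⁆∪A⇒W′
    where
    ⁅v⁆∪A⊆W : ⁅ v ⁆ ∪ A ⊆ W
    ⁅v⁆∪A⊆W x∈ with x∈p∪q⁻ ⁅ v ⁆ A x∈
    ... | inj₁ x∈v = subst (_∈ W) (sym (x∈⁅y⁆⇒x≡y v x∈v)) v∈
    ... | inj₂ x∈A = proj₁ (∈-nbrs⁻ D W (A⊆ x∈A))
    ⁅v⁆∪A⇒W′ : (⁅ v ⁆ ∪ A) ⇒[ D ] W′
    ⁅v⁆∪A⇒W′ x∈ y∈ with x∈p∪q⁻ ⁅ v ⁆ A x∈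
    ... | inj₂ x∈A = A⇒W′ x∈A y∈
    ... | inj₁ x∈v with refl ← x∈⁅y⁆⇒x≡y v x∈v = proj₂ (∈-nbrs⁻ D W (W′⊆ y∈))

-- Strong connectivity from a cyclic core

-- The explicit witness `P` lets an undeleted neighbour be picked by comparing sizes with `S`.
DominatesIn : ℕ → Digraph n → Fin n → Subset n → Set
DominatesIn k D v C = ∃[ P ] (k ≤ ∣ P ∣ × P ⊆ C × (∀ {w} → w ∈ P → T (D v w)))

-- `D` and `E` may be oppositely oriented: arcs reversed by the inversion are treated by flipping
-- just one of them.
nbrs⇒DominatesIn : ∀ {k v} (D E : Digraph n) {W C} → W ⊆ C → k ≤ ∣ nbrs D W v ∣ →
                   (∀ {w} → w ∈ W → T (D v w) → T (E v w)) → DominatesIn k E v C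
nbrs⇒DominatesIn D E {W} W⊆C k≤ D⇒E =
  _ , k≤ , W⊆C ∘ proj₁ ∘ ∈-nbrs⁻ D W , λ w∈ → let w∈W , vw = ∈-nbrs⁻ D W w∈ in D⇒E w∈W vw

module _ {k : ℕ} {D : Digraph n} {A B Z : Subset n}
  (k≤A : k ≤ ∣ A ∣) (k≤B : k ≤ ∣ B ∣) (k≤Z : k ≤ ∣ Z ∣)
  (A⇒Z : A ⇒[ D ] Z) (Z⇒B : Z ⇒[ D ] B) (B⇒A : B ⇒[ D ] A)
  (toCore   : ∀ v → v ∉ (A ∪ B) ∪ Z → DominatesIn k D v ((A ∪ B) ∪ Z))
  (fromCore : ∀ v → v ∉ (A ∪ B) ∪ Z → DominatesIn k (flip D) v ((A ∪ B) ∪ Z))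
  where

  -- Each of `A`, `B`, `Z` keeps a vertex after deletion. The survivor `a` serves as a hub that
  -- every remaining vertex reaches and is reached from.
  cyclicCore⇒stronglyConnected : ∀ S → ∣ S ∣ < k → StronglyConnectedMinus D S
  cyclicCore⇒stronglyConnected S S<k u v u∉ v∉ = reaches u∉ ◅◅ reached v∉
    where
    C = (A ∪ B) ∪ Z
    _⟶*_ = Star (ArcMinus D S)

    survivor : ∀ P → k ≤ ∣ P ∣ → ∃[ x ] (x ∈ P × x ∉ S)
    survivor P k≤P = ∣q∣<∣p∣⇒∃∈p∉q P S (<-≤-trans S<k k≤P)

    a b z : Fin n
    a = proj₁ (survivor A k≤A)
    b = proj₁ (survivor B k≤B)
    z = proj₁ (survivor Z k≤Z)

    a∈ : a ∈ A
    a∈ = proj₁ (proj₂ (survivor A k≤A))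
    b∈ : b ∈ B
    b∈ = proj₁ (proj₂ (survivor B k≤B))
    z∈ : z ∈ Z
    z∈ = proj₁ (proj₂ (survivor Z k≤Z))

    a∉ : a ∉ S
    a∉ = proj₂ (proj₂ (survivor A k≤A))
    b∉ : b ∉ S
    b∉ = proj₂ (proj₂ (survivor B k≤B))
    z∉ : z ∉ S
    z∉ = proj₂ (proj₂ (survivor Z k≤Z))

    core : ∀ {x} → x ∈ C → x ∈ A ⊎ x ∈ B ⊎ x ∈ Z
    core x∈ with x∈p∪q⁻ (A ∪ B) Z x∈
    ... | inj₂ x∈Z = inj₂ (inj₂ x∈Z)
    ... | inj₁ x∈Y with x∈p∪q⁻ A B x∈Y
    ...   | inj₁ x∈A = inj₁ x∈A
    ...   | inj₂ x∈B = inj₂ (inj₁ x∈B)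

    coreReaches : ∀ {x} → x ∉ S → x ∈ C → x ⟶* a
    coreReaches x∉ x∈ with core x∈
    -- Nothing is known about arcs inside `A`, so the path goes once round the cycle.
    ... | inj₁ x∈A        = (x∉ , z∉ , A⇒Z x∈A z∈) ◅ (z∉ , b∉ , Z⇒B z∈ b∈) ◅ (b∉ , a∉ , B⇒A b∈ a∈) ◅ ε
    ... | inj₂ (inj₁ x∈B) = (x∉ , a∉ , B⇒A x∈B a∈) ◅ ε
    ... | inj₂ (inj₂ x∈Z) = (x∉ , b∉ , Z⇒B x∈Z b∈) ◅ (b∉ , a∉ , B⇒A b∈ a∈) ◅ ε

    coreReached : ∀ {x} → x ∉ S → x ∈ C → a ⟶* x
    coreReached x∉ x∈ with core x∈
    ... | inj₁ x∈A        = (a∉ , z∉ , A⇒Z a∈ z∈) ◅ (z∉ , b∉ , Z⇒B z∈ b∈) ◅ (b∉ , x∉ , B⇒A b∈ x∈A) ◅ ε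
    ... | inj₂ (inj₁ x∈B) = (a∉ , z∉ , A⇒Z a∈ z∈) ◅ (z∉ , x∉ , Z⇒B z∈ x∈B) ◅ ε
    ... | inj₂ (inj₂ x∈Z) = (a∉ , x∉ , A⇒Z a∈ x∈Z) ◅ ε

    reaches : ∀ {x} → x ∉ S → x ⟶* a
    reaches {x} x∉ with x ∈? C
    ... | yes x∈C = coreReaches x∉ x∈C
    ... | no  x∉C with P , k≤P , P⊆C , arcs ← toCore x x∉C
                  with w , w∈ , w∉ ← survivor P k≤P = (x∉ , w∉ , arcs w∈) ◅ coreReaches w∉ (P⊆C w∈)

    reached : ∀ {x} → x ∉ S → a ⟶* x
    reached {x} x∉ with x ∈? C
    ... | yes x∈C = coreReached x∉ x∈C
    ... | no  x∉C with P , k≤P , P⊆C , arcs ← fromCore x x∉C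
                  with w , w∈ , w∉ ← survivor P k≤P = coreReached w∉ (P⊆C w∈) ◅◅ ((w∉ , x∉ , arcs w∈) ◅ ε)

-- One inversion

module _ (X : Subset n) (D : Digraph n) where

  invert-∈∈ : ∀ {u v} → u ∈ X → v ∈ X → T (D v u) → T (invert X D u v)
  invert-∈∈ {u} {v} u∈ v∈ vu rewrite dec-true (u ∈? X) u∈ | dec-true (v ∈? X) v∈ = vu

  invert-∉ˡ : ∀ {u v} → u ∉ X → T (D u v) → T (invert X D u v)
  invert-∉ˡ {u} {v} u∉ uv rewrite dec-false (u ∈? X) u∉ = uv

  invert-∉ʳ : ∀ {u v} → v ∉ X → T (D u v) → T (invert X D u v)
  invert-∉ʳ {u} {v} v∉ uv with u ∈? X
  ... | no  _ = uv
  ... | yes _ rewrite dec-false (v ∈? X) v∉ = uv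

module _ {k : ℕ} {D : Digraph n} (tour : IsTournament D) {A B Z : Subset n} (1≤k : 1 ≤ k)
  (k≤A : k ≤ ∣ A ∣) (k≤B : k ≤ ∣ B ∣) (2k-1≤Z : 2 * k ∸ 1 ≤ ∣ Z ∣)
  (A⇒Z : A ⇒[ D ] Z) (Z⇒B : Z ⇒[ D ] B) (A⇒B : A ⇒[ D ] B)
  where

  private
    Y C : Subset n
    Y = A ∪ B
    C = Y ∪ Z

    A⊆Y : A ⊆ Y
    A⊆Y = p⊆p∪q B

    B⊆Y : B ⊆ Y
    B⊆Y = q⊆p∪q A B

    Y⊆C : Y ⊆ C
    Y⊆C = p⊆p∪q Z

    Z⊆C : Z ⊆ C
    Z⊆C = q⊆p∪q Y Z

  -- These vertices already have `k` core neighbours in each direction, found in opposite parts, so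
  -- their arcs may stay as they are.
  Balanced : Fin n → Set
  Balanced v = (k ≤ ∣ nbrs D Y v ∣ × k ≤ ∣ nbrs (flip D) Z v ∣)
             ⊎ (k ≤ ∣ nbrs (flip D) Y v ∣ × k ≤ ∣ nbrs D Z v ∣)

  balanced? : Decidable Balanced
  balanced? v = (k ≤? _ ×-dec k ≤? _) ⊎-dec (k ≤? _ ×-dec k ≤? _)

  private
    InX? : Decidable λ v → v ∈ Y ⊎ (v ∉ C × ¬ Balanced v)
    InX? v = v ∈? Y ⊎-dec (¬? (v ∈? C) ×-dec ¬? (balanced? v))

  invertedSet : Subset n
  invertedSet = select InX?

  private
    X : Subset n
    X = invertedSet

    D′ : Digraph n
    D′ = invert X D

    Y⊆X : Y ⊆ X
    Y⊆X v∈ = ∈-select⁺ InX? (inj₁ v∈)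

    -- This keeps every arc with an end in `Z` unchanged by the inversion.
    Z∩X=∅ : ∀ {z} → z ∈ Z → z ∉ X
    Z∩X=∅ z∈Z z∈X with ∈-select⁻ InX? z∈X
    ... | inj₂ (z∉C , _) = z∉C (Z⊆C z∈Z)
    ... | inj₁ z∈Y with x∈p∪q⁻ A B z∈Y
    ...   | inj₁ z∈A = ⇒-disjoint tour A⇒Z z∈A z∈Z
    ...   | inj₂ z∈B = ⇒-disjoint tour Z⇒B z∈Z z∈B

    balanced⇒∉X : ∀ {v} → v ∉ C → Balanced v → v ∉ X
    balanced⇒∉X v∉C bal v∈X with ∈-select⁻ InX? v∈X
    ... | inj₁ v∈Y        = v∉C (Y⊆C v∈Y)
    ... | inj₂ (_ , ¬bal) = ¬bal bal

    unbalanced⇒∈X : ∀ {v} → v ∉ C → ¬ Balanced v → v ∈ X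
    unbalanced⇒∈X v∉C ¬bal = ∈-select⁺ InX? (inj₂ (v∉C , ¬bal))

    2k-1≤Y : 2 * k ∸ 1 ≤ ∣ Y ∣
    2k-1≤Y = begin
      2 * k ∸ 1      ≤⟨ m∸n≤m (2 * k) 1 ⟩
      2 * k          ≡⟨ cong (k +_) (+-identityʳ k) ⟩
      k + k          ≤⟨ +-mono-≤ k≤A k≤B ⟩
      ∣ A ∣ + ∣ B ∣  ≤⟨ disjoint⇒∣p∣+∣q∣≤∣p∪q∣ A B (⇒-disjoint tour A⇒B) ⟩
      ∣ Y ∣          ∎
      where open ≤-Reasoning

    k≤Z : k ≤ ∣ Z ∣
    -- From `1 ≤ k` comes `k + 1 ≤ 2 * k`, hence `k ≤ 2 * k ∸ 1`.
    k≤Z = ≤-trans (m+n≤o⇒m≤o∸n k (subst (k + 1 ≤_) (sym (cong (k +_) (+-identityʳ k))) (+-monoʳ-≤ k 1≤k))) 2k-1≤Z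

    coreBothWays : ∀ v → v ∉ C → DominatesIn k D′ v C × DominatesIn k (flip D′) v C
    coreBothWays v v∉C with balanced? v
    ... | yes bal@(inj₁ (outY , inZ)) =
            nbrs⇒DominatesIn D D′ Y⊆C outY (λ _ → invert-∉ˡ X D (balanced⇒∉X v∉C bal))
          , nbrs⇒DominatesIn (flip D) (flip D′) Z⊆C inZ (λ _ → invert-∉ʳ X D (balanced⇒∉X v∉C bal))
    ... | yes bal@(inj₂ (inY , outZ)) =
            nbrs⇒DominatesIn D D′ Z⊆C outZ (λ _ → invert-∉ˡ X D (balanced⇒∉X v∉C bal))
          , nbrs⇒DominatesIn (flip D) (flip D′) Y⊆C inY (λ _ → invert-∉ʳ X D (balanced⇒∉X v∉C bal))
    -- Opposite majorities in `Y` and `Z` would make `v` balanced, so the two directions agree.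
    ... | no ¬bal with majority tour Y 2k-1≤Y (v∉C ∘ Y⊆C) | majority tour Z 2k-1≤Z (v∉C ∘ Z⊆C)
    ...   | inj₁ outY | inj₂ inZ  = contradiction (inj₁ (outY , inZ)) ¬bal
    ...   | inj₂ inY  | inj₁ outZ = contradiction (inj₂ (inY , outZ)) ¬bal
    ...   | inj₁ outY | inj₁ outZ =
            nbrs⇒DominatesIn D D′ Z⊆C outZ (λ w∈Z → invert-∉ʳ X D (Z∩X=∅ w∈Z))
          -- Both ends lie in `X`, so the out-neighbours in `Y` become in-neighbours.
          , nbrs⇒DominatesIn D (flip D′) Y⊆C outY (λ w∈Y → invert-∈∈ X D (Y⊆X w∈Y) (unbalanced⇒∈X v∉C ¬bal))
    ...   | inj₂ inY  | inj₂ inZ  =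
            nbrs⇒DominatesIn (flip D) D′ Y⊆C inY (λ w∈Y → invert-∈∈ X D (unbalanced⇒∈X v∉C ¬bal) (Y⊆X w∈Y))
          , nbrs⇒DominatesIn (flip D) (flip D′) Z⊆C inZ (λ w∈Z → invert-∉ˡ X D (Z∩X=∅ w∈Z))

    k+1≤n : k + 1 ≤ n
    k+1≤n with b , b∈ ← 1≤∣p∣⇒Nonempty B (≤-trans 1≤k k≤B) = begin
      k + 1              ≡⟨ +-comm k 1 ⟩
      1 + k              ≤⟨ s≤s k≤A ⟩
      1 + ∣ A ∣          ≤⟨ x∉p⇒∣p∣<∣⁅x⁆∪p∣ A (λ b∈A → ⇒-disjoint tour A⇒B b∈A b∈) ⟩
      ∣ ⁅ b ⁆ ∪ A ∣      ≤⟨ ∣p∣≤n (⁅ b ⁆ ∪ A) ⟩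
      n                  ∎
      where open ≤-Reasoning

  invertedSet-strong : Strong k (invert invertedSet D)
  invertedSet-strong = k+1≤n , cyclicCore⇒stronglyConnected k≤A k≤B k≤Z
    (λ a∈ z∈ → invert-∉ʳ X D (Z∩X=∅ z∈) (A⇒Z a∈ z∈))
    (λ z∈ b∈ → invert-∉ˡ X D (Z∩X=∅ z∈) (Z⇒B z∈ b∈))
    (λ b∈ a∈ → invert-∈∈ X D (Y⊆X (B⊆Y b∈)) (Y⊆X (A⊆Y a∈)) (A⇒B a∈ b∈))
    (λ v v∉C → proj₁ (coreBothWays v v∉C))
    (λ v v∉C → proj₂ (coreBothWays v v∉C))

-- Existence of the core in a large tournament

oneInversion : ∀ k {D : Digraph n} → 1 ≤ k → IsTournament D → (2 * k ∸ 1) * 2 ^ (2 * k) ≤ n →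
               ∃[ X ] Strong k (invert X D)
oneInversion {n} k {D} 1≤k tour big =
  -- The remaining `W` keeps a factor `2 ^ k` in its size bound for the second search.
  let A , W , _ , _ , k≤A , W-big , A⇒W = dominatingSubset tour k ((2 * k ∸ 1) * 2 ^ k) ⊤ (*-mono-≤ 1≤2k-1 (m^n>0 2 k)) big′
      -- In the flipped tournament the dominating set receives all arcs from `Z`; since `B` lies
      -- inside `W`, it is also dominated by `A`.
      B , Z , B⊆W , Z⊆W , k≤B , Z-big , B⇐Z = dominatingSubset (flip-isTournament tour) k (2 * k ∸ 1) W 1≤2k-1 W-big
  in _ , invertedSet-strong tour 1≤k k≤A k≤B Z-big
          (λ a∈ z∈ → A⇒W a∈ (Z⊆W z∈)) (λ z∈ b∈ → B⇐Z b∈ z∈) (λ a∈ b∈ → A⇒W a∈ (B⊆W b∈))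
  where
  1≤2k-1 : 1 ≤ 2 * k ∸ 1
  1≤2k-1 = m+n≤o⇒m≤o∸n 1 (*-monoʳ-≤ 2 1≤k)
  big′ : (2 * k ∸ 1) * 2 ^ k * 2 ^ k ≤ ∣ ⊤ {n} ∣
  big′ = begin
    (2 * k ∸ 1) * 2 ^ k * 2 ^ k    ≡⟨ *-assoc (2 * k ∸ 1) (2 ^ k) (2 ^ k) ⟩
    (2 * k ∸ 1) * (2 ^ k * 2 ^ k)  ≡⟨ cong ((2 * k ∸ 1) *_) (^-distribˡ-+-* 2 k k) ⟨
    (2 * k ∸ 1) * 2 ^ (k + k)      ≡⟨ cong (λ e → (2 * k ∸ 1) * 2 ^ (k + e)) (+-identityʳ k) ⟨
    (2 * k ∸ 1) * 2 ^ (2 * k)      ≤⟨ big ⟩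
    n                              ≡⟨ ∣⊤∣≡n n ⟨
    ∣ ⊤ {n} ∣                      ∎
    where open ≤-Reasoning

-- The two minimum numbers of inversions

-- The empty sequence is the only one of length 0, so once it fails every successful length is at
-- least 1.
positive : {P : ∀ {m} → Vec (Subset n) m → Set} → ¬ P [] → ∀ m → ∃[ Xs ] P {m} Xs → 1 ≤ m
positive ¬P zero    ([] , p) = contradiction p ¬P
positive ¬P (suc m) _        = s≤s z≤n

theorem6p1 : ∀ (k n : ℕ) → 1 ≤ k → (T : Digraph n) → IsTournament T →
    (2 * k ∸ 1) * 2 ^ (2 * k) ≤ n →
    ∃[ a ] ∃[ b ] (Sinv′≡ k T a × Sinv≡ k T b × a ≤ b × b ≤ 1)
theorem6p1 k n 1≤k T tour big with strong? k T | arcStrong? k T | oneInversion k 1≤k tour big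
-- Strength implies arc-strength, which leaves three possible pairs of minima.
... | yes s | _     | _     = 0 , 0 , (([] , Strong⇒ArcStrong s) , λ _ _ → z≤n) , (([] , s) , λ _ _ → z≤n) , z≤n , z≤n
... | no ¬s | yes a | X , s =
  0 , 1 , (([] , a) , λ _ _ → z≤n) , ((X ∷ [] , s) , positive ¬s) , z≤n , ≤-refl
... | no ¬s | no ¬a | X , s =
  1 , 1 , ((X ∷ [] , Strong⇒ArcStrong s) , positive ¬a) , ((X ∷ [] , s) , positive ¬s) , ≤-refl , ≤-refl
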